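{- There is an absolute constant $C>0$ such that the following holds. Let $b\ge1$ and $k\ge0$ be integers, $G$ a graph and $(P,\beta)$ a path-decomposition of $G$ with adhesion at most $k$, such that for every bag $\beta(t)$ and every subset $A\subseteq\beta(t)$, $\mathrm{bn}(G[A])\le b$. Then $\mathrm{bn}(G)\le b\cdot 2^{2^{C\max(k,1)^2}}$.
   Context: All graphs are finite and simple. Basis number: subsets of $E(G)$ form an $\mathbb{F}_2$-vector space under symmetric difference; an $\mathbb{F}_2$-cycle is a subgraph with all degrees even; these form the cycle space, a cycle basis is a basis of it; the congestion of a family of subgraphs is the maximum over edges $e$ of the number of members containing $e$; $\mathrm{bn}(G)$ is the minimum congestion of a cycle basis. A path-decomposition is a tree-decomposition $(P,\beta)$ whose tree $P$ is a path: bags $\beta(t)$ cover all vertices and all edges, and bags containing a given vertex form a subpath. Its adhesions are the intersections of consecutive bags; adhesion at most $k$ means each has size at most $k$. -}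

module Defs where

open import Data.Nat using (ℕ; zero; suc; _+_; _*_; _≤_; _<_; _⊔_)
open import Data.Nat.Base using (_%_)
open import Data.Bool using (Bool; true; false; _∧_; _xor_; if_then_else_)
open import Data.Fin using (Fin; toℕ)
open import Data.Fin.Base using () renaming (zero to fz; suc to fs)
open import Data.Product using (Σ; ∃; _×_; _,_)
open import Relation.Binary.PropositionalEquality using (_≡_)

record Graph : Set where
  field
    n     : ℕ
    adj   : Fin n → Fin n → Bool
    sym   : ∀ u v → adj u v ≡ adj v u
    irr   : ∀ v → adj v v ≡ false
open Graph public

VSet : ℕ → Set
VSet n = Fin n → Bool

count : ∀ {m} → (Fin m → Bool) → ℕ
count {zero}  p = 0
count {suc m} p = (if p fz then 1 else 0) + count (λ i → p (fs i))

-- Edge subsets (elements of the F₂-vector space of subsets of E(G)),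
-- represented by their indicator on ordered pairs, symmetric and
-- contained in E(G).
ESet : ℕ → Set
ESet n = Fin n → Fin n → Bool

IsEdgeSubset : (G : Graph) → ESet (n G) → Set
IsEdgeSubset G S =
  (∀ u v → S u v ≡ S v u) × (∀ u v → S u v ≡ true → adj G u v ≡ true)

_⊕_ : ∀ {n} → ESet n → ESet n → ESet n
(S ⊕ T) u v = S u v xor T u v

∅ₑ : ∀ {n} → ESet n
∅ₑ u v = false

_≐_ : ∀ {n} → ESet n → ESet n → Set
S ≐ T = ∀ u v → S u v ≡ T u v

lincomb : ∀ {n} (d : ℕ) → (Fin d → Bool) → (Fin d → ESet n) → ESet n
lincomb zero    c B = ∅ₑ
lincomb (suc d) c B =
  (if c fz then B fz else ∅ₑ) ⊕ lincomb d (λ i → c (fs i)) (λ i → B (fs i))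

Even : ℕ → Set
Even m = m % 2 ≡ 0

IsF2Cycle : (G : Graph) → ESet (n G) → Set
IsF2Cycle G S = IsEdgeSubset G S × (∀ u → Even (count (S u)))

record CycleBasis (G : Graph) : Set where
  field
    dim     : ℕ
    vec     : Fin dim → ESet (n G)
    cyc     : ∀ i → IsF2Cycle G (vec i)
    indep   : ∀ (c : Fin dim → Bool) → lincomb dim c vec ≐ ∅ₑ → ∀ i → c i ≡ false
    spans   : ∀ (S : ESet (n G)) → IsF2Cycle G S →
              Σ (Fin dim → Bool) (λ c → lincomb dim c vec ≐ S)
open CycleBasis public

CongestionLe : (G : Graph) → CycleBasis G → ℕ → Set
CongestionLe G B m =
  ∀ u v → adj G u v ≡ true → count (λ i → vec B i u v) ≤ m

BnLe : Graph → ℕ → Set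
BnLe G m = Σ (CycleBasis G) (λ B → CongestionLe G B m)

-- Induced subgraph G[A], realised on the same vertex set Fin n with the
-- vertices outside A made isolated (isolated vertices do not affect the
-- cycle space, hence not bn).
induced : (G : Graph) → VSet (n G) → Graph
induced G A = record
  { n   = n G
  ; adj = λ u v → A u ∧ A v ∧ adj G u v
  ; sym = symA
  ; irr = irrA
  }
  where
  open import Data.Bool.Properties using (∧-comm; ∧-assoc; ∧-zeroʳ)
  open import Relation.Binary.PropositionalEquality using (cong; cong₂; trans; sym)
  symA : ∀ u v → (A u ∧ A v ∧ adj G u v) ≡ (A v ∧ A u ∧ adj G v u)
  symA u v with A u | A v
  ... | false | false = _≡_.refl
  ... | false | true  = _≡_.refl
  ... | true  | false = _≡_.refl
  ... | true  | true  = Graph.sym G u v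
  irrA : ∀ v → (A v ∧ A v ∧ adj G v v) ≡ false
  irrA v = trans (cong (λ x → A v ∧ A v ∧ x) (Graph.irr G v)) (trans (cong (A v ∧_) (∧-zeroʳ (A v))) (∧-zeroʳ (A v)))

_⊆ᵥ_ : ∀ {n} → VSet n → VSet n → Set
A ⊆ᵥ B = ∀ v → A v ≡ true → B v ≡ true

-- Path-decompositions: the path P has nodes 0,1,…,p-1 (consecutive
-- nodes adjacent), bags β(t) ⊆ V(G).
record PathDecomposition (G : Graph) : Set where
  field
    len   : ℕ
    bag   : Fin len → VSet (n G)
    coverV : ∀ v → ∃ λ t → bag t v ≡ true
    coverE : ∀ u v → adj G u v ≡ true → ∃ λ t → (bag t u ≡ true) × (bag t v ≡ true)
    interp : ∀ v (s t r : Fin len) → toℕ s ≤ toℕ t → toℕ t ≤ toℕ r →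
             bag s v ≡ true → bag r v ≡ true → bag t v ≡ true
open PathDecomposition public

AdhesionLe : (G : Graph) → PathDecomposition G → ℕ → Set
AdhesionLe G D k =
  ∀ (s t : Fin (len D)) → toℕ t ≡ suc (toℕ s) →
    count (λ v → bag D s v ∧ bag D t v) ≤ k

{-# OPTIONS --safe #-}

module Submission where

-- A vertex v occupies an interval [f v , l v] of the path; give the edge uv the
-- index f u ⊔ f v. A cycle cut between bags i − 1 and i leaves a chain of edges of
-- index < i whose boundary lies in the adhesion, so modulo cycles on either side
-- there are at most k independent chains to remember. Sweeping the path, we keep a
-- list of finished cycles and at most k pending chains which together span all
-- chains with boundary in the current adhesion. Bag i contributes a cycle basis of
-- its edges of index i (obtained from one of G[β(i)] by forcing the at most k²
-- coordinates inside the adhesion to vanish, each at the cost of doubling the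
-- congestion) and at most 2k chains with boundary in the two adhesions; Gaussian
-- elimination then restores the invariant. As elimination only adds younger chains
-- to older ones, an edge of index i never spreads beyond the at most 3k chains alive
-- at bag i. The congestion is therefore at most 3k + 2^(k²) b.

open import Defs hiding (sym)
open import Data.Nat as ℕ using (ℕ; zero; suc; _+_; _*_; _^_; _⊔_; _≤_; _<_; z≤n; s≤s; _≤?_; _<?_)
open import Data.Nat.Properties hiding (_≟_)
open import Data.Nat.DivMod using (_%_)
open import Data.Bool using (Bool; true; false; not; _∧_; _xor_; if_then_else_; _≟_)
open import Data.Bool.Properties
  using (xor-same; xor-comm; xor-assoc; xor-identityʳ; not-distribˡ-xor; ∧-conicalˡ; ∧-conicalʳ; not-injective)
open import Data.Fin as Fin using (Fin; toℕ)
open import Data.Fin.Base using () renaming (zero to fz; suc to fs)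
open import Data.Fin.Properties as Fin using (all?)
open import Data.List using (List; []; _∷_; _++_; map; length; filter; cartesianProduct; cartesianProductWith)
open import Data.List.Properties using (length-map; length-++; map-++; ++-assoc)
open import Data.List.Membership.Propositional using (_∈_; find)
open import Data.List.Membership.Propositional.Properties
  using (∈-map⁺; ∈-filter⁺; ∈-cartesianProduct⁺; ∈-cartesianProduct⁻)
open import Data.List.Relation.Unary.All as All using (All; []; _∷_)
open import Data.List.Relation.Unary.All.Properties as All using ()
open import Data.List.Relation.Unary.Any as Any using (Any; here; there)
open import Data.List.Relation.Unary.Any.Properties as Any using ()
open import Data.Product using (Σ; ∃; _×_; _,_; proj₁; proj₂)
open import Data.Sum using (_⊎_; inj₁; inj₂; [_,_])
open import Function using (_∘_; id)
open import Relation.Nullary using (Dec; yes; no; ¬_; contradiction; ⌊_⌋)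
open import Relation.Nullary.Decidable using (_×-dec_; _⊎-dec_; _→-dec_)
open import Relation.Binary.PropositionalEquality
  using (_≡_; refl; sym; trans; cong; cong₂; subst; module ≡-Reasoning)

-- Identities for bits and exclusive or.

bit : Bool → ℕ
bit b = if b then 1 else 0

xor-medial : ∀ a b c d → (a xor b) xor (c xor d) ≡ (a xor c) xor (b xor d)
xor-medial false b c d = trans (sym (xor-assoc b c d)) (trans (cong (_xor d) (xor-comm b c)) (xor-assoc c b d))
xor-medial true  b c d =
  trans (sym (not-distribˡ-xor b (c xor d)))
        (trans (cong not (xor-medial false b c d)) (not-distribˡ-xor c (b xor d)))

xor-cancelʳ : ∀ a b → (a xor b) xor b ≡ a
xor-cancelʳ a b = trans (xor-assoc a b b) (trans (cong (a xor_) (xor-same b)) (xor-identityʳ a))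

xor-cancel-outer : ∀ a b → (a xor b) xor a ≡ b
xor-cancel-outer a b = trans (cong (_xor a) (xor-comm a b)) (xor-cancelʳ b a)

xor-true : ∀ a b → a xor b ≡ true → a ≡ true ⊎ b ≡ true
xor-true true  b e = inj₁ refl
xor-true false b e = inj₂ e

private variable N : ℕ

-- Linear algebra over F₂

≐-refl : {x : ESet N} → x ≐ x
≐-refl u v = refl

≐-sym : {x y : ESet N} → x ≐ y → y ≐ x
≐-sym p u v = sym (p u v)

≐-trans : {x y z : ESet N} → x ≐ y → y ≐ z → x ≐ z
≐-trans p q u v = trans (p u v) (q u v)

⊕-cong : {x x′ y y′ : ESet N} → x ≐ x′ → y ≐ y′ → (x ⊕ y) ≐ (x′ ⊕ y′)
⊕-cong p q u v = cong₂ _xor_ (p u v) (q u v)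

⊕-cancelʳ : (x y : ESet N) → ((x ⊕ y) ⊕ y) ≐ x
⊕-cancelʳ x y u v = xor-cancelʳ (x u v) (y u v)

record Subspace (W : ESet N → Set) : Set where
  field
    resp  : ∀ {x y} → x ≐ y → W x → W y
    has-∅ : W ∅ₑ
    add   : ∀ {x y} → W x → W y → W (x ⊕ y)
open Subspace

_∩_ : {W W′ : ESet N → Set} → Subspace W → Subspace W′ → Subspace (λ x → W x × W′ x)
resp  (s ∩ t) e (w , w′) = resp s e w , resp t e w′
has-∅ (s ∩ t) = has-∅ s , has-∅ t
add   (s ∩ t) (w , w′) (z , z′) = add s w z , add t w′ z′

record Functional (N : ℕ) : Set where
  field
    ap      : ESet N → Bool
    ap-cong : ∀ {x y} → x ≐ y → ap x ≡ ap y
    ap-⊕    : ∀ x y → ap (x ⊕ y) ≡ ap x xor ap y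
open Functional

ap-∅ : (φ : Functional N) → ap φ ∅ₑ ≡ false
ap-∅ φ = trans (ap-⊕ φ ∅ₑ ∅ₑ) (xor-same (ap φ ∅ₑ))

Ker : (φ : Functional N) → Subspace (λ x → ap φ x ≡ false)
resp  (Ker φ) e p = trans (sym (ap-cong φ e)) p
has-∅ (Ker φ) = ap-∅ φ
add   (Ker φ) {x} {y} p q = trans (ap-⊕ φ x y) (cong₂ _xor_ p q)

coord : Fin N → Fin N → Functional N
ap      (coord u v) x = x u v
ap-cong (coord u v) e = e u v
ap-⊕    (coord u v) x y = refl

parity : ∀ {m} → (Fin m → Bool) → Bool
parity {zero}  p = false
parity {suc m} p = p fz xor parity (λ i → p (fs i))

parity-cong : ∀ {m} {p q : Fin m → Bool} → (∀ i → p i ≡ q i) → parity p ≡ parity q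
parity-cong {zero}  e = refl
parity-cong {suc m} e = cong₂ _xor_ (e fz) (parity-cong (λ i → e (fs i)))

parity-xor : ∀ {m} (p q : Fin m → Bool) → parity (λ i → p i xor q i) ≡ parity p xor parity q
parity-xor {zero}  p q = refl
parity-xor {suc m} p q =
  trans (cong ((p fz xor q fz) xor_) (parity-xor (λ i → p (fs i)) (λ i → q (fs i))))
        (xor-medial (p fz) (q fz) _ _)

parity-false : ∀ {m} (p : Fin m → Bool) → (∀ i → p i ≡ false) → parity p ≡ false
parity-false {zero}  p e = refl
parity-false {suc m} p e = cong₂ _xor_ (e fz) (parity-false _ (λ i → e (fs i)))

suc-%2 : ∀ m b → m % 2 ≡ bit b → suc m % 2 ≡ bit (not b)
suc-%2 zero          false e = refl
suc-%2 zero          true  ()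
suc-%2 (suc zero)    true  e = refl
suc-%2 (suc zero)    false ()
suc-%2 (suc (suc m)) b     e = suc-%2 m b e

-- Connects degrees, which are natural numbers, with `parity`, which is linear.
count-%2 : ∀ {m} (p : Fin m → Bool) → count p % 2 ≡ bit (parity p)
count-%2 {zero}  p = refl
count-%2 {suc m} p with p fz
... | false = count-%2 (λ i → p (fs i))
... | true  = suc-%2 (count (λ i → p (fs i))) (parity (λ i → p (fs i))) (count-%2 (λ i → p (fs i)))

even⇒parity : ∀ {m} (p : Fin m → Bool) → Even (count p) → parity p ≡ false
even⇒parity p e with parity p | count-%2 p
... | false | _ = refl
... | true  | q = contradiction (trans (sym e) q) (λ ())

parity⇒even : ∀ {m} (p : Fin m → Bool) → parity p ≡ false → Even (count p)
parity⇒even p e = trans (count-%2 p) (cong bit e)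

-- The coefficient at `v` of the boundary of an edge set: its degree at `v` modulo 2.
∂ : Fin N → Functional N
ap      (∂ v) x = parity (x v)
ap-cong (∂ v) e = parity-cong (e v)
ap-⊕    (∂ v) x y = parity-xor (x v) (y v)

-- Each entry is either omitted or used once. In this form membership is decidable, and coefficients
-- stay implicit until a `CycleBasis` has to be built.
Span : List (ESet N) → ESet N → Set
Span []      x = x ≐ ∅ₑ
Span (b ∷ B) x = Span B x ⊎ Span B (x ⊕ b)

Span-resp : (B : List (ESet N)) {x y : ESet N} → x ≐ y → Span B x → Span B y
Span-resp []      e p        = ≐-trans (≐-sym e) p
Span-resp (b ∷ B) e (inj₁ p) = inj₁ (Span-resp B e p)
Span-resp (b ∷ B) e (inj₂ p) = inj₂ (Span-resp B (⊕-cong e ≐-refl) p)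

Span-∅ : (B : List (ESet N)) → Span B ∅ₑ
Span-∅ []      = ≐-refl
Span-∅ (b ∷ B) = inj₁ (Span-∅ B)

Span-⊕ : (B : List (ESet N)) {x y : ESet N} → Span B x → Span B y → Span B (x ⊕ y)
Span-⊕ []      p q = ⊕-cong p q
Span-⊕ (b ∷ B) (inj₁ p) (inj₁ q) = inj₁ (Span-⊕ B p q)
Span-⊕ (b ∷ B) {x} {y} (inj₁ p) (inj₂ q) =
  inj₂ (Span-resp B (λ u v → sym (xor-assoc (x u v) (y u v) (b u v))) (Span-⊕ B p q))
Span-⊕ (b ∷ B) {x} {y} (inj₂ p) (inj₁ q) =
  inj₂ (Span-resp B (λ u v → trans (xor-assoc (x u v) (b u v) (y u v))
                              (trans (cong (x u v xor_) (xor-comm (b u v) (y u v)))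
                                     (sym (xor-assoc (x u v) (y u v) (b u v)))))
                  (Span-⊕ B p q))
Span-⊕ (b ∷ B) {x} {y} (inj₂ p) (inj₂ q) =
  inj₁ (Span-resp B (λ u v → trans (xor-medial (x u v) (b u v) (y u v) (b u v))
                              (trans (cong ((x u v xor y u v) xor_) (xor-same (b u v)))
                                     (xor-identityʳ _)))
                  (Span-⊕ B p q))

Span-subspace : (B : List (ESet N)) → Subspace (Span B)
resp  (Span-subspace B) = Span-resp B
has-∅ (Span-subspace B) = Span-∅ B
add   (Span-subspace B) = Span-⊕ B

Span-least : {W : ESet N → Set} → Subspace W → {B : List (ESet N)} → All W B → ∀ {x} → Span B x → W x
Span-least s []       p            = resp s (≐-sym p) (has-∅ s)
Span-least s (w ∷ ws) (inj₁ p)     = Span-least s ws p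
Span-least s {b ∷ B} (w ∷ ws) {x} (inj₂ p) =
  resp s (⊕-cancelʳ x b) (add s (Span-least s ws p) w)

Span-∷ : (b : ESet N) (B : List (ESet N)) → Span (b ∷ B) b
Span-∷ b B = inj₂ (Span-resp B (λ u v → sym (xor-same (b u v))) (Span-∅ B))

Span-self : (B : List (ESet N)) → All (Span B) B
Span-self []      = []
Span-self (b ∷ B) = Span-∷ b B ∷ All.map inj₁ (Span-self B)

Span-trans : {B C : List (ESet N)} → All (Span C) B → ∀ {x} → Span B x → Span C x
Span-trans {C = C} = Span-least (Span-subspace C)

Span-++ʳ : (B C : List (ESet N)) {x : ESet N} → Span C x → Span (B ++ C) x
Span-++ʳ []      C p = p
Span-++ʳ (b ∷ B) C p = inj₁ (Span-++ʳ B C p)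

Span-++ˡ : (B C : List (ESet N)) {x : ESet N} → Span B x → Span (B ++ C) x
Span-++ˡ B C = Span-trans (All.++⁻ˡ B (Span-self (B ++ C)))

Span-∈ : {B : List (ESet N)} {y : ESet N} → y ∈ B → Span B y
Span-∈ {B = B} y∈B = All.lookup (Span-self B) y∈B

≐? : (x y : ESet N) → Dec (x ≐ y)
≐? x y = all? (λ u → all? (λ v → x u v ≟ y u v))

Span? : (B : List (ESet N)) (x : ESet N) → Dec (Span B x)
Span? []      x = ≐? x ∅ₑ
Span? (b ∷ B) x = Span? B x ⊎-dec Span? B (x ⊕ b)

congestion : Fin N → Fin N → List (ESet N) → ℕ
congestion u v []      = 0
congestion u v (b ∷ B) = bit (b u v) + congestion u v B

congestion-++ : (u v : Fin N) (B C : List (ESet N)) →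
  congestion u v (B ++ C) ≡ congestion u v B + congestion u v C
congestion-++ u v []      C = refl
congestion-++ u v (b ∷ B) C =
  trans (cong (bit (b u v) +_) (congestion-++ u v B C)) (sym (+-assoc (bit (b u v)) _ _))

congestion-0 : (u v : Fin N) (B : List (ESet N)) → All (λ b → b u v ≡ false) B → congestion u v B ≡ 0
congestion-0 u v []      []       = refl
congestion-0 u v (b ∷ B) (e ∷ es) = cong₂ _+_ (cong bit e) (congestion-0 u v B es)

-- Extracting a basis from a spanning list

-- A triangular form of linear independence, suited to a greedy choice from the end of the list.
data Independent {N} : List (ESet N) → Set where
  []  : Independent []
  _∷_ : ∀ {b B} → ¬ Span B b → Independent B → Independent (b ∷ B)

-- Greedy choice, possible because `Span` is decidable. The clause quantified over `W` records that
-- the members of `C` come from `B`.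
extract-basis : (B : List (ESet N)) → Σ (List (ESet N)) λ C →
  Independent C × All (Span C) B
  × (∀ {W : ESet N → Set} → All W B → All W C)
  × (∀ u v → congestion u v C ≤ congestion u v B)
extract-basis [] = [] , [] , [] , id , λ u v → z≤n
extract-basis (b ∷ B) with extract-basis B
... | C , ind , sp , al , cg with Span? C b
... | yes p = C , ind , p ∷ sp , (λ { (w ∷ ws) → al ws }) ,
              λ u v → ≤-trans (cg u v) (m≤n+m _ (bit (b u v)))
... | no ¬p = b ∷ C , ¬p ∷ ind , Span-∷ b C ∷ All.map inj₁ sp , (λ { (w ∷ ws) → w ∷ al ws }) ,
              λ u v → +-monoʳ-≤ (bit (b u v)) (cg u v)

vector : (B : List (ESet N)) → Fin (length B) → ESet N
vector (b ∷ B) fz     = b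
vector (b ∷ B) (fs i) = vector B i

All-vector : {W : ESet N → Set} {B : List (ESet N)} → All W B → ∀ i → W (vector B i)
All-vector (w ∷ ws) fz     = w
All-vector (w ∷ ws) (fs i) = All-vector ws i

count-vector : (u v : Fin N) (B : List (ESet N)) → count (λ i → vector B i u v) ≡ congestion u v B
count-vector u v []      = refl
count-vector u v (b ∷ B) = cong (bit (b u v) +_) (count-vector u v B)

lincomb-∈-Span : (B : List (ESet N)) (c : Fin (length B) → Bool) → Span B (lincomb (length B) c (vector B))
lincomb-∈-Span []      c = ≐-refl
lincomb-∈-Span (b ∷ B) c with c fz
... | false = inj₁ (lincomb-∈-Span B (λ i → c (fs i)))
... | true  = inj₂ (Span-resp B
  (λ u v → sym (xor-cancel-outer (b u v) _))
  (lincomb-∈-Span B (λ i → c (fs i))))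

Span⇒lincomb : (B : List (ESet N)) {x : ESet N} → Span B x →
  Σ (Fin (length B) → Bool) λ c → lincomb (length B) c (vector B) ≐ x
Span⇒lincomb []      p = (λ ()) , ≐-sym p
Span⇒lincomb (b ∷ B) (inj₁ p) with Span⇒lincomb B p
... | c , e = (λ { fz → false ; (fs i) → c i }) , e
Span⇒lincomb (b ∷ B) {x} (inj₂ p) with Span⇒lincomb B p
... | c , e = (λ { fz → true ; (fs i) → c i }) ,
  λ u v → trans (cong (b u v xor_) (e u v)) (trans (xor-comm (b u v) _) (xor-cancelʳ (x u v) (b u v)))

independent⇒ : {B : List (ESet N)} → Independent B → ∀ c →
  lincomb (length B) c (vector B) ≐ ∅ₑ → ∀ i → c i ≡ false
independent⇒ {B = b ∷ B} (¬p ∷ ind) c e i with c fz in eq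
independent⇒ {B = b ∷ B} (¬p ∷ ind) c e fz     | false = eq
independent⇒ {B = b ∷ B} (¬p ∷ ind) c e (fs i) | false = independent⇒ ind (λ i → c (fs i)) e i
-- A nonzero first coefficient would express `b` through the later vectors.
independent⇒ {B = b ∷ B} (¬p ∷ ind) c e i      | true  = contradiction
  (Span-resp B (λ u v → trans (sym (xor-cancelʳ _ (b u v)))
                              (cong (_xor b u v) (trans (xor-comm _ (b u v)) (e u v))))
             (lincomb-∈-Span B (λ i → c (fs i))))
  ¬p

-- Discarding redundant vectors cannot raise the congestion, so the constructions below need only
-- produce spanning lists of cycles.
spanning⇒BnLe : (G : Graph) (m : ℕ) (B : List (ESet (n G))) → All (IsF2Cycle G) B →
  (∀ x → IsF2Cycle G x → Span B x) →
  (∀ u v → adj G u v ≡ true → congestion u v B ≤ m) → BnLe G m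
spanning⇒BnLe G m B cycles sp cg with extract-basis B
... | C , ind , B⊆C , al , cg′ = record
  { dim   = length C
  ; vec   = vector C
  ; cyc   = All-vector (al cycles)
  ; indep = independent⇒ ind
  ; spans = λ x cx → Span⇒lincomb C (Span-trans B⊆C (sp x cx))
  } , λ u v a → ≤-trans (≤-reflexive (count-vector u v C)) (≤-trans (cg′ u v) (cg u v a))

vectors : (d : ℕ) → (Fin d → ESet N) → List (ESet N)
vectors zero    b = []
vectors (suc d) b = b fz ∷ vectors d (λ i → b (fs i))

All-vectors : {W : ESet N → Set} (d : ℕ) (b : Fin d → ESet N) → (∀ i → W (b i)) → All W (vectors d b)
All-vectors zero    b w = []
All-vectors (suc d) b w = w fz ∷ All-vectors d _ (λ i → w (fs i))

congestion-vectors : (u v : Fin N) (d : ℕ) (b : Fin d → ESet N) →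
  congestion u v (vectors d b) ≡ count (λ i → b i u v)
congestion-vectors u v zero    b = refl
congestion-vectors u v (suc d) b = cong (bit (b fz u v) +_) (congestion-vectors u v d _)

Span-vectors : (d : ℕ) (c : Fin d → Bool) (b : Fin d → ESet N) → Span (vectors d b) (lincomb d c b)
Span-vectors zero    c b = ≐-refl
Span-vectors (suc d) c b with c fz
... | false = inj₁ (Span-vectors d _ _)
... | true  = inj₂ (Span-resp (vectors d _)
  (λ u v → sym (xor-cancel-outer (b fz u v) _))
  (Span-vectors d _ _))

-- Elimination in lists of aged vectors

-- The age of a vector is a lower bound for the edge indices in its support.
-- The pivot is always a youngest vector and is only added to older ones, so
-- elimination preserves these bounds.
Aged : ℕ → Set
Aged N = ℕ × ESet N

chains : List (Aged N) → List (ESet N)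
chains = map proj₂

-- The number of vectors whose age permits an edge of index `t`. For vectors that respect their ages
-- it dominates the congestion at such an edge, and unlike congestion it does not grow under
-- elimination.
started : ℕ → List (Aged N) → ℕ
started t []            = 0
started t ((a , _) ∷ P) = bit ⌊ a ≤? t ⌋ + started t P

bit≤1 : ∀ b → bit b ≤ 1
bit≤1 false = z≤n
bit≤1 true  = ≤-refl

started-++ : ∀ t (P R : List (Aged N)) → started t (P ++ R) ≡ started t P + started t R
started-++ t []            R = refl
started-++ t ((a , _) ∷ P) R =
  trans (cong (bit ⌊ a ≤? t ⌋ +_) (started-++ t P R)) (sym (+-assoc (bit ⌊ a ≤? t ⌋) _ _))

started≤length : ∀ t (P : List (Aged N)) → started t P ≤ length P
started≤length t []            = z≤n
started≤length t ((a , _) ∷ P) = +-mono-≤ (bit≤1 ⌊ a ≤? t ⌋) (started≤length t P)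

hits : Functional N → List (Aged N) → ℕ
hits φ []            = 0
hits φ ((_ , x) ∷ P) = bit (ap φ x) + hits φ P

hits-coord : ∀ u v (P : List (Aged N)) → hits (coord u v) P ≡ congestion u v (chains P)
hits-coord u v []            = refl
hits-coord u v ((_ , x) ∷ P) = cong (bit (x u v) +_) (hits-coord u v P)

Vanishes : Functional N → Aged N → Set
Vanishes φ (_ , x) = ap φ x ≡ false

-- Closure under the only additions that elimination performs: a vector is added to one at least as
-- old, and the sum keeps the older age.
MixClosed : (Aged N → Set) → Set
MixClosed W = ∀ {a b} x y → a ≤ b → W (a , x) → W (b , y) → W (a , x ⊕ y)

subspace⇒mixClosed : {W : ESet N → Set} → Subspace W → MixClosed (W ∘ proj₂)
subspace⇒mixClosed s _ _ _ = add s

-- Gaussian elimination of one functional. In the congestion clause every vector with `φ`-value 1 is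
-- charged an increase of at most one.
data Eliminated (φ : Functional N) (P : List (Aged N)) : Set₁ where
  done  : All (Vanishes φ) P → Eliminated φ P
  pivot : (q : Aged N) (R : List (Aged N)) →
    ap φ (proj₂ q) ≡ true →
    All (Vanishes φ) R →
    (∀ t → started t (q ∷ R) ≡ started t P) →
    All (Span (chains (q ∷ R))) (chains P) →
    (∀ {W} → MixClosed W → All W P → All W (q ∷ R)) →
    (∀ u v → congestion u v (chains (q ∷ R)) ≤ congestion u v (chains P) + hits φ P) →
    Eliminated φ P

+-swap : ∀ a b c → a + (b + c) ≡ b + (a + c)
+-swap a b c = trans (sym (+-assoc a b c)) (trans (cong (_+ c) (+-comm a b)) (+-assoc b a c))

+-shift-suc : ∀ a b c → a + suc (b + c) ≡ (a + b) + suc c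
+-shift-suc a b c = trans (cong (a +_) (sym (+-suc b c))) (sym (+-assoc a b (suc c)))

Span-add⁻ : {B : List (ESet N)} {x y : ESet N} → Span B (x ⊕ y) → Span B y → Span B x
Span-add⁻ {B = B} {x} {y} p q = Span-resp B (⊕-cancelʳ x y) (Span-⊕ B p q)

Span-swap : (b c : ESet N) {B : List (ESet N)} {x : ESet N} → Span (b ∷ B) x → Span (b ∷ c ∷ B) x
Span-swap b c {B} = Span-trans (Span-∷ b (c ∷ B) ∷ All.map (λ p → inj₁ (inj₁ p)) (Span-self B))

eliminate-∷ : (φ : Functional N) (p : Aged N) {P : List (Aged N)} → Eliminated φ P → Eliminated φ (p ∷ P)
eliminate-∷ φ (a , x) e with ap φ x in φx
eliminate-∷ φ (a , x)     (done zs) | false = done (φx ∷ zs)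
eliminate-∷ φ (a , x) {P} (done zs) | true  =
  pivot (a , x) P φx zs (λ t → refl) (Span-self _) (λ _ w → w) (λ u v → m≤m+n _ _)
eliminate-∷ φ (a , x) {P} (pivot (b , y) R φy zs ages gen closed cg) | false =
  pivot (b , y) ((a , x) ∷ R) φy (φx ∷ zs)
    (λ t → trans (+-swap (bit ⌊ b ≤? t ⌋) (bit ⌊ a ≤? t ⌋) _) (cong (bit ⌊ a ≤? t ⌋ +_) (ages t)))
    (inj₁ (Span-∷ x _) ∷ All.map (Span-swap y x) gen)
    (λ { m (w ∷ ws) → All.head (closed m ws) ∷ w ∷ All.tail (closed m ws) })
    (λ u v → begin
      bit (y u v) + (bit (x u v) + congestion u v (chains R)) ≡⟨ +-swap (bit (y u v)) (bit (x u v)) _ ⟩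
      bit (x u v) + (bit (y u v) + congestion u v (chains R)) ≤⟨ +-monoʳ-≤ (bit (x u v)) (cg u v) ⟩
      bit (x u v) + (congestion u v (chains P) + hits φ P)    ≡⟨ +-assoc (bit (x u v)) _ _ ⟨
      (bit (x u v) + congestion u v (chains P)) + hits φ P    ≡⟨ cong (λ z → (bit (x u v) + congestion u v (chains P)) + (bit z + hits φ P)) φx ⟨
      (bit (x u v) + congestion u v (chains P)) + (bit (ap φ x) + hits φ P) ∎)
  where open ≤-Reasoning
eliminate-∷ φ (a , x) {P} (pivot (b , y) R φy zs ages gen closed cg) | true with a ≤? b
-- The pivot `y` is at least as young as `x`, so it stays pivot and is added to `x`.
... | yes a≤b = pivot (b , y) ((a , x ⊕ y) ∷ R) φy (trans (ap-⊕ φ x y) (cong₂ _xor_ φx φy) ∷ zs)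
    (λ t → trans (+-swap (bit ⌊ b ≤? t ⌋) (bit ⌊ a ≤? t ⌋) _) (cong (bit ⌊ a ≤? t ⌋ +_) (ages t)))
    (Span-add⁻ (inj₁ (Span-∷ (x ⊕ y) _)) (Span-∷ y _) ∷ All.map (Span-swap y (x ⊕ y)) gen)
    (λ { m (w ∷ ws) → All.head (closed m ws) ∷ m x y a≤b w (All.head (closed m ws)) ∷ All.tail (closed m ws) })
    (λ u v → begin
      bit (y u v) + (bit (x u v xor y u v) + congestion u v (chains R))
        ≤⟨ +-monoʳ-≤ (bit (y u v)) (+-monoˡ-≤ _ (bit≤1 (x u v xor y u v))) ⟩
      bit (y u v) + suc (congestion u v (chains R))              ≡⟨ +-suc _ _ ⟩
      suc (bit (y u v) + congestion u v (chains R))              ≤⟨ s≤s (cg u v) ⟩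
      suc (congestion u v (chains P) + hits φ P)                 ≤⟨ m≤n+m _ (bit (x u v)) ⟩
      bit (x u v) + suc (congestion u v (chains P) + hits φ P)   ≡⟨ +-shift-suc (bit (x u v)) _ _ ⟩
      (bit (x u v) + congestion u v (chains P)) + suc (hits φ P) ≡⟨ cong (λ z → (bit (x u v) + congestion u v (chains P)) + (bit z + hits φ P)) φx ⟨
      (bit (x u v) + congestion u v (chains P)) + (bit (ap φ x) + hits φ P) ∎)
  where open ≤-Reasoning
-- Now `x` is strictly younger and takes over as pivot. As `φ` already vanishes on `R`, only the
-- former pivot `y` needs correcting.
... | no a≰b = pivot (a , x) ((b , y ⊕ x) ∷ R) φx (trans (ap-⊕ φ y x) (cong₂ _xor_ φy φx) ∷ zs)
    (λ t → cong (bit ⌊ a ≤? t ⌋ +_) (ages t))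
    (Span-∷ x _ ∷ All.map
      (Span-trans (Span-add⁻ (inj₁ (Span-∷ (y ⊕ x) _)) (Span-∷ x _)
                   ∷ All.map (λ p → inj₁ (inj₁ p)) (Span-self (chains R)))) gen)
    (λ { m (w ∷ ws) → w ∷ m y x (≰⇒≥ a≰b) (All.head (closed m ws)) w ∷ All.tail (closed m ws) })
    (λ u v → begin
      bit (x u v) + (bit (y u v xor x u v) + congestion u v (chains R))
        ≤⟨ +-monoʳ-≤ (bit (x u v)) (+-mono-≤ (bit≤1 (y u v xor x u v)) (m≤n+m _ (bit (y u v)))) ⟩
      bit (x u v) + suc (bit (y u v) + congestion u v (chains R)) ≤⟨ +-monoʳ-≤ (bit (x u v)) (s≤s (cg u v)) ⟩
      bit (x u v) + suc (congestion u v (chains P) + hits φ P)   ≡⟨ +-shift-suc (bit (x u v)) _ _ ⟩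
      (bit (x u v) + congestion u v (chains P)) + suc (hits φ P) ≡⟨ cong (λ z → (bit (x u v) + congestion u v (chains P)) + (bit z + hits φ P)) φx ⟨
      (bit (x u v) + congestion u v (chains P)) + (bit (ap φ x) + hits φ P) ∎)
  where open ≤-Reasoning

eliminate : (φ : Functional N) (P : List (Aged N)) → Eliminated φ P
eliminate φ []      = done []
eliminate φ (p ∷ P) = eliminate-∷ φ p (eliminate φ P)

-- Since `φ` is nonzero only on `q`, it reads off the coefficient of `q`, which is zero for a vector
-- killed by `φ`.
drop-pivot : (φ : Functional N) (q : ESet N) {B : List (ESet N)} → ap φ q ≡ true → All (λ b → ap φ b ≡ false) B →
  ∀ {x} → ap φ x ≡ false → Span (q ∷ B) x → Span B x
drop-pivot φ q φq zs φx (inj₁ p) = p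
drop-pivot φ q φq zs {x} φx (inj₂ p) =
  contradiction (trans (sym (Span-least (Ker φ) zs p)) (trans (ap-⊕ φ x q) (cong₂ _xor_ φx φq))) (λ ())

-- Elimination of several functionals with all pivots discarded; what remains still generates the
-- common kernel. `Q` stands for vectors already in this kernel, which are left untouched: in the
-- sweep, the cycles found so far.
record Kernel {I : Set} (φ : I → Functional N) (is : List I) (P : List (Aged N)) : Set₁ where
  field
    rest      : List (Aged N)
    vanishing : All (λ i → All (Vanishes (φ i)) rest) is
    ages      : ∀ t → started t rest ≤ started t P
    closed    : ∀ {W} → MixClosed W → All W P → All W rest
    generates : ∀ Q → All (λ i → All (λ q → ap (φ i) q ≡ false) Q) is →
                ∀ {x} → All (λ i → ap (φ i) x ≡ false) is →
                Span (chains P ++ Q) x → Span (chains rest ++ Q) x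

kernel : {I : Set} (φ : I → Functional N) (is : List I) (P : List (Aged N)) → Kernel φ is P
kernel φ [] P = record
  { rest = P ; vanishing = [] ; ages = λ t → ≤-refl ; closed = λ _ w → w ; generates = λ _ _ _ s → s }
kernel φ (i ∷ is) P with eliminate (φ i) P
... | done zs = record
  { rest      = K.rest
  ; vanishing = K.closed (subspace⇒mixClosed (Ker (φ i))) zs ∷ K.vanishing
  ; ages      = K.ages
  ; closed    = K.closed
  ; generates = λ { Q (_ ∷ zQ) (_ ∷ zx) → K.generates Q zQ zx }
  }
  where module K = Kernel (kernel φ is P)
... | pivot (b , y) R φy zs ages gen closed _ = record
  { rest      = K.rest
  -- Later eliminations only form sums within `R`, where `φ i` is already zero.
  ; vanishing = K.closed (subspace⇒mixClosed (Ker (φ i))) zs ∷ K.vanishing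
  ; ages      = λ t → ≤-trans (K.ages t) (≤-trans (m≤n+m _ (bit ⌊ b ≤? t ⌋)) (≤-reflexive (ages t)))
  ; closed    = λ m w → K.closed m (All.tail (closed m w))
  ; generates = λ { Q (z ∷ zQ) (zx ∷ zxs) s → K.generates Q zQ zxs
      (drop-pivot (φ i) y φy (All.++⁺ (All.map⁺ zs) z) zx
        (Span-trans (All.++⁺ (All.map (Span-++ˡ (y ∷ chains R) Q) gen)
                             (All.++⁻ʳ (y ∷ chains R) (Span-self (y ∷ chains R ++ Q)))) s)) }
  }
  where module K = Kernel (kernel φ is R)

-- The same elimination with the pivots kept, at most one per functional. This is the source of
-- every bound on the number of chains.
record Pivots {I : Set} (φ : I → Functional N) (is : List I) (P : List (Aged N)) : Set₁ where
  field
    kept rest : List (Aged N)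
    bounded   : length kept ≤ length is
    vanishing : All (λ i → All (Vanishes (φ i)) rest) is
    ages      : ∀ t → started t kept + started t rest ≡ started t P
    closed    : ∀ {W} → MixClosed W → All W P → All W kept × All W rest
    generates : All (Span (chains kept ++ chains rest)) (chains P)

pivots : {I : Set} (φ : I → Functional N) (is : List I) (P : List (Aged N)) → Pivots φ is P
pivots φ [] P = record
  { kept = [] ; rest = P ; bounded = z≤n ; vanishing = [] ; ages = λ t → refl
  ; closed = λ _ w → [] , w ; generates = Span-self (chains P) }
pivots φ (i ∷ is) P with eliminate (φ i) P
... | done zs = record
  { kept      = K.kept
  ; rest      = K.rest
  ; bounded   = m≤n⇒m≤1+n K.bounded
  ; vanishing = proj₂ (K.closed (subspace⇒mixClosed (Ker (φ i))) zs) ∷ K.vanishing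
  ; ages      = K.ages
  ; closed    = K.closed
  ; generates = K.generates
  }
  where module K = Pivots (pivots φ is P)
... | pivot (b , y) R φy zs ages gen closed _ = record
  { kept      = (b , y) ∷ K.kept
  ; rest      = K.rest
  ; bounded   = s≤s K.bounded
  ; vanishing = proj₂ (K.closed (subspace⇒mixClosed (Ker (φ i))) zs) ∷ K.vanishing
  ; ages      = λ t → trans (+-assoc (bit ⌊ b ≤? t ⌋) _ _)
                      (trans (cong (bit ⌊ b ≤? t ⌋ +_) (K.ages t)) (ages t))
  ; closed    = λ m w → let (wk , wr) = K.closed m (All.tail (closed m w)) in All.head (closed m w) ∷ wk , wr
  ; generates = All.map (Span-trans (Span-∷ y _ ∷ All.map inj₁ K.generates)) gen
  }
  where module K = Pivots (pivots φ is R)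

-- Finite enumerations

cons : {A : Set} {m : ℕ} → A → (Fin m → A) → Fin (suc m) → A
cons a g fz     = a
cons a g (fs i) = g i

functions : {A : Set} (m : ℕ) → List A → List (Fin m → A)
functions zero    as = (λ ()) ∷ []
functions (suc m) as = cartesianProductWith cons as (functions m as)

-- Stated up to a pointwise relation so that it can be applied twice, first to the rows of an edge
-- set and then to the edge set itself.
functions-complete : {A : Set} (R : A → A → Set) {as : List A} (m : ℕ) (g : Fin m → A) →
  (∀ i → Any (R (g i)) as) → Any (λ h → ∀ i → R (g i) (h i)) (functions m as)
functions-complete R zero    g p = here (λ ())
functions-complete R (suc m) g p =
  Any.cartesianProductWith⁺ cons (λ { r rs fz → r ; r rs (fs i) → rs i })
    (p fz) (functions-complete R m (λ i → g (fs i)) (λ i → p (fs i)))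

edgeSets : (N : ℕ) → List (ESet N)
edgeSets N = functions N (functions N (true ∷ false ∷ []))

edgeSets-complete : (x : ESet N) → Any (x ≐_) (edgeSets N)
edgeSets-complete {N} x =
  functions-complete (λ p q → ∀ i → p i ≡ q i) N x
    (λ u → functions-complete _≡_ N (x u) (λ v → bool (x u v)))
  where
  bool : ∀ b → Any (b ≡_) (true ∷ false ∷ [])
  bool true  = here refl
  bool false = there (here refl)

-- The list may be exponentially long. This is harmless: only a few pivots extracted from it
-- survive, and a cycle basis replaces the remainder.
enumerate : {W : ESet N → Set} → (∀ x → Dec (W x)) → (∀ {x y} → x ≐ y → W x → W y) →
  Σ (List (ESet N)) λ B → All W B × (∀ {x} → W x → Span B x)
enumerate {N} W? W-resp = filter W? (edgeSets N) , All.all-filter W? (edgeSets N) ,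
  λ {x} w → let (y , y∈ , x≐y) = find (edgeSets-complete x) in
    Span-resp _ (≐-sym x≐y) (Span-∈ (∈-filter⁺ W? y∈ (W-resp x≐y w)))

length-cartesianProduct : {A B : Set} (as : List A) (bs : List B) →
  length (cartesianProduct as bs) ≡ length as * length bs
length-cartesianProduct []       bs = refl
length-cartesianProduct (a ∷ as) bs =
  trans (length-++ (map (a ,_) bs)) (cong₂ _+_ (length-map (a ,_) bs) (length-cartesianProduct as bs))

members : ∀ {m} → (Fin m → Bool) → List (Fin m)
members {zero}  p = []
members {suc m} p = if p fz then fz ∷ rest else rest
  where rest = map fs (members (λ i → p (fs i)))

length-members : ∀ {m} (p : Fin m → Bool) → length (members p) ≡ count p
length-members {zero}  p = refl
length-members {suc m} p with p fz
... | true  = cong suc (trans (length-map fs (members (λ i → p (fs i)))) (length-members (λ i → p (fs i))))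
... | false = trans (length-map fs (members (λ i → p (fs i)))) (length-members (λ i → p (fs i)))

count-0 : ∀ {m} (p : Fin m → Bool) → (∀ i → p i ≡ false) → count p ≡ 0
count-0 {zero}  p e = refl
count-0 {suc m} p e = cong₂ _+_ (cong bit (e fz)) (count-0 (λ i → p (fs i)) (λ i → e (fs i)))

∈-members : ∀ {m} (p : Fin m → Bool) {i} → p i ≡ true → i ∈ members p
∈-members {suc m} p {fz}   e with p fz
∈-members {suc m} p {fz}   refl | true = here refl
∈-members {suc m} p {fs i} e with p fz
... | true  = there (∈-map⁺ fs (∈-members (λ j → p (fs j)) e))
... | false = ∈-map⁺ fs (∈-members (λ j → p (fs j)) e)

members-sound : ∀ {m} (p : Fin m → Bool) → All (λ i → p i ≡ true) (members p)
members-sound {zero}  p = []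
members-sound {suc m} p with p fz in eq
... | true  = eq ∷ All.map⁺ (members-sound (λ i → p (fs i)))
... | false = All.map⁺ (members-sound (λ i → p (fs i)))

-- Deleting edges from a spanning list of cycles

record Avoiding (is : List (Fin N × Fin N)) (P : List (Aged N)) (c : ℕ) : Set₁ where
  field
    rest      : List (Aged N)
    vanishing : All (λ (u , v) → All (Vanishes (coord u v)) rest) is
    closed    : ∀ {W} → MixClosed W → All W P → All W rest
    generates : ∀ {x} → All (λ (u , v) → x u v ≡ false) is → Span (chains P) x → Span (chains rest) x
    congested : ∀ u v → congestion u v (chains rest) ≤ 2 ^ length is * c

-- Clearing a coordinate hits as many vectors as the congestion there, at most `c`, and each hit
-- costs at most one. Hence every pair at most doubles the bound.
avoid : (is : List (Fin N × Fin N)) (P : List (Aged N)) (c : ℕ) →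
  (∀ u v → congestion u v (chains P) ≤ c) → Avoiding is P c
avoid [] P c cg = record
  { rest = P ; vanishing = [] ; closed = λ _ w → w ; generates = λ _ s → s
  ; congested = λ u v → ≤-trans (cg u v) (≤-reflexive (sym (+-identityʳ c))) }
avoid ((u₀ , v₀) ∷ is) P c cg with eliminate (coord u₀ v₀) P
... | done zs = record
  { rest      = K.rest
  ; vanishing = K.closed (subspace⇒mixClosed (Ker (coord u₀ v₀))) zs ∷ K.vanishing
  ; closed    = K.closed
  ; generates = λ { (_ ∷ zx) → K.generates zx }
  ; congested = λ u v → ≤-trans (K.congested u v) (*-monoˡ-≤ c (m≤m+n (2 ^ length is) _))
  }
  where module K = Avoiding (avoid is P c cg)
... | pivot (b , y) R φy zs _ gen closed cg′ = record
  { rest      = K.rest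
  ; vanishing = K.closed (subspace⇒mixClosed (Ker (coord u₀ v₀))) zs ∷ K.vanishing
  ; closed    = λ m w → K.closed m (All.tail (closed m w))
  ; generates = λ { (zx ∷ zxs) s → K.generates zxs
      (drop-pivot (coord u₀ v₀) y φy (All.map⁺ zs) zx (Span-trans gen s)) }
  ; congested = λ u v → ≤-trans (K.congested u v) (≤-reflexive double)
  }
  where
  doubled : ∀ u v → congestion u v (chains R) ≤ c + c
  doubled u v = begin
    congestion u v (chains R)                           ≤⟨ m≤n+m _ (bit (y u v)) ⟩
    congestion u v (chains ((b , y) ∷ R))               ≤⟨ cg′ u v ⟩
    congestion u v (chains P) + hits (coord u₀ v₀) P
      ≤⟨ +-mono-≤ (cg u v) (≤-trans (≤-reflexive (hits-coord u₀ v₀ P)) (cg u₀ v₀)) ⟩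
    c + c ∎
    where open ≤-Reasoning
  module K = Avoiding (avoid is R (c + c) doubled)
  double : 2 ^ length is * (c + c) ≡ 2 ^ suc (length is) * c
  double = begin
    2 ^ length is * (c + c) ≡⟨ cong (λ z → 2 ^ length is * (c + z)) (+-identityʳ c) ⟨
    2 ^ length is * (2 * c) ≡⟨ *-assoc (2 ^ length is) 2 c ⟨
    2 ^ length is * 2 * c   ≡⟨ cong (_* c) (*-comm (2 ^ length is) 2) ⟩
    2 ^ suc (length is) * c ∎
    where open ≡-Reasoning

at-age : ℕ → List (ESet N) → List (Aged N)
at-age a = map (a ,_)

chains-at-age : (a : ℕ) (B : List (ESet N)) → chains (at-age a B) ≡ B
chains-at-age a []      = refl
chains-at-age a (b ∷ B) = cong (b ∷_) (chains-at-age a B)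

-- Chains in graphs

Chain : (Fin N → Fin N → Set) → ESet N → Set
Chain M x = (∀ u v → x u v ≡ x v u) × (∀ u v → x u v ≡ true → M u v)

Cycle : (Fin N → Fin N → Set) → ESet N → Set
Cycle M x = Chain M x × (∀ v → ap (∂ v) x ≡ false)

Chain-subspace : (M : Fin N → Fin N → Set) → Subspace (Chain M)
resp  (Chain-subspace M) e (s , p) =
  (λ u v → trans (sym (e u v)) (trans (s u v) (e v u))) , λ u v q → p u v (trans (e u v) q)
has-∅ (Chain-subspace M) = (λ u v → refl) , λ u v ()
add   (Chain-subspace M) {x} {y} (s , p) (t , q) =
  (λ u v → cong₂ _xor_ (s u v) (t u v)) , λ u v e → [ p u v , q u v ] (xor-true (x u v) (y u v) e)

⋂ : {I : Set} {W : I → ESet N → Set} → (∀ i → Subspace (W i)) → Subspace (λ x → ∀ i → W i x)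
resp  (⋂ s) e w i   = resp (s i) e (w i)
has-∅ (⋂ s) i       = has-∅ (s i)
add   (⋂ s) w w′ i  = add (s i) (w i) (w′ i)

Cycle-subspace : (M : Fin N → Fin N → Set) → Subspace (Cycle M)
Cycle-subspace M = Chain-subspace M ∩ ⋂ (λ v → Ker (∂ v))

Chain-mono : {M M′ : Fin N → Fin N → Set} → (∀ u v → M u v → M′ u v) → ∀ {x} → Chain M x → Chain M′ x
Chain-mono h (s , p) = s , λ u v e → h u v (p u v e)

Chain-false : {M : Fin N → Fin N → Set} {x : ESet N} → Chain M x → ∀ u v → ¬ M u v → x u v ≡ false
Chain-false {x = x} (_ , p) u v ¬m with x u v in eq
... | false = refl
... | true  = contradiction (p u v eq) ¬m

Chain? : {M : Fin N → Fin N → Set} → (∀ u v → Dec (M u v)) → ∀ x → Dec (Chain M x)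
Chain? M? x = all? (λ u → all? (λ v → x u v ≟ x v u))
        ×-dec all? (λ u → all? (λ v → (x u v ≟ true) →-dec M? u v))

Adj : (G : Graph) → Fin (n G) → Fin (n G) → Set
Adj G u v = adj G u v ≡ true

cycle⇒F2Cycle : (G : Graph) {x : ESet (n G)} → Cycle (Adj G) x → IsF2Cycle G x
cycle⇒F2Cycle G {x} (c , z) = c , λ v → parity⇒even (x v) (z v)

F2Cycle⇒cycle : (G : Graph) {x : ESet (n G)} → IsF2Cycle G x → Cycle (Adj G) x
F2Cycle⇒cycle G {x} (c , z) = c , λ v → even⇒parity (x v) (z v)

⌊⌋-true : {P : Set} (d : Dec P) → ⌊ d ⌋ ≡ true → P
⌊⌋-true (yes p) e = p

⌊⌋-false : {P : Set} (d : Dec P) → ⌊ d ⌋ ≡ false → ¬ P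
⌊⌋-false (no ¬p) e = ¬p

true-⌊⌋ : {P : Set} (d : Dec P) → P → ⌊ d ⌋ ≡ true
true-⌊⌋ (yes _) p = refl
true-⌊⌋ (no ¬p) p = contradiction p ¬p

false-⌊⌋ : {P : Set} (d : Dec P) → ¬ P → ⌊ d ⌋ ≡ false
false-⌊⌋ (yes p) ¬p = contradiction p ¬p
false-⌊⌋ (no _)  ¬p = refl

-- With `[f v, l v]` as the interval of `v`, `Boundary f l i` is the adhesion between bags `i - 1`
-- and `i`; it is empty for `i = 0`.
Boundary Bag : (f l : Fin N → ℕ) → ℕ → VSet N
Boundary f l i v = ⌊ (f v <? i) ×-dec (i ≤? l v) ⌋
Bag      f l i v = ⌊ (f v ≤? i) ×-dec (i ≤? l v) ⌋

∂-vanishing : (p : VSet N) {P : List (Aged N)} → All (λ v → All (Vanishes (∂ v)) P) (members p) →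
  ∀ v → p v ≡ true → All (Vanishes (∂ v)) P
∂-vanishing p z v e = All.lookup z (∈-members p e)

-- Graphs laid out along intervals.

module Layout (G : Graph) (f l : Fin (n G) → ℕ) (k b : ℕ)
  (f≤l : ∀ v → f v ≤ l v)
  (edge : ∀ u v → Adj G u v → f u ≤ l v)
  (narrow : ∀ i → count (Boundary f l i) ≤ k)
  (local : ∀ i → BnLe (induced G (Bag f l i)) b) where

  V : Set
  V = Fin (n G)

  -- The intervals of adjacent vertices meet, so for an edge this is the first bag containing both
  -- ends.
  index : V → V → ℕ
  index u v = f u ⊔ f v

  boundary : ℕ → VSet (n G)
  boundary = Boundary f l

  At Before : ℕ → V → V → Set
  At     i u v = Adj G u v × index u v ≡ i
  Before i u v = Adj G u v × index u v < i

  Within : ℕ → ℕ → V → V → Set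
  Within a i u v = Adj G u v × a ≤ index u v × index u v < i

  Good : ℕ → Aged (n G) → Set
  Good i (a , x) = Chain (Within a i) x

  -- The older age bounds the edge indices of both summands from below.
  Good-mix : ∀ i → MixClosed (Good i)
  Good-mix i {a} x y a≤b g h =
    add (Chain-subspace (Within a i)) g
        (Chain-mono (λ u v (adj , b≤ , <i) → adj , ≤-trans a≤b b≤ , <i) h)

  Partial : ℕ → ESet (n G) → Set
  Partial i x = Chain (Before i) x × (∀ v → boundary i v ≡ false → ap (∂ v) x ≡ false)

  adj-sym : ∀ {u v} → Adj G u v → Adj G v u
  adj-sym {u} {v} a = trans (Graph.sym G v u) a

  index≤lˡ : ∀ {u v} → Adj G u v → index u v ≤ l u
  index≤lˡ {u} {v} a = ⊔-lub (f≤l u) (edge v u (adj-sym a))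

  index≤lʳ : ∀ {u v} → Adj G u v → index u v ≤ l v
  index≤lʳ {u} {v} a = ⊔-lub (edge u v a) (f≤l v)

  -- Cycles within a single index.

  record LocalCycles (i : ℕ) : Set where
    field
      cycles    : List (ESet (n G))
      sound     : All (Cycle (At i)) cycles
      generates : ∀ {x} → Cycle (At i) x → Span cycles x
      congested : ∀ u v → congestion u v cycles ≤ 2 ^ (k * k) * b

  module _ (i : ℕ) where
    private
      H : Graph
      H = induced G (Bag f l i)

      basis : CycleBasis H
      basis = proj₁ (local i)

      vs : List (ESet (n G))
      vs = vectors (dim basis) (vec basis)

      vs-sound : All (Cycle (Adj H)) vs
      vs-sound = All-vectors (dim basis) (vec basis) (λ j → F2Cycle⇒cycle H (cyc basis j))

      congested-vs : ∀ u v → congestion u v vs ≤ b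
      congested-vs u v with adj H u v ≟ true
      ... | yes a = ≤-trans (≤-reflexive (congestion-vectors u v (dim basis) (vec basis))) (proj₂ (local i) u v a)
      -- No cycle of `H` meets a non-edge, so the bound extends to all pairs, as `avoid` requires.
      ... | no ¬a = ≤-trans (≤-reflexive (congestion-0 u v vs
                      (All.map (λ c → Chain-false (proj₁ c) u v ¬a) vs-sound))) z≤n

      pairs : List (V × V)
      pairs = cartesianProduct (members (boundary i)) (members (boundary i))

      length-pairs : length pairs ≤ k * k
      length-pairs = ≤-trans (≤-reflexive (length-cartesianProduct (members (boundary i)) (members (boundary i))))
                             (*-mono-≤ bound bound)
        where
        bound : length (members (boundary i)) ≤ k
        bound = ≤-trans (≤-reflexive (length-members (boundary i))) (narrow i)

      module K = Avoiding (avoid pairs (at-age 0 vs) b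
        (λ u v → ≤-trans (≤-reflexive (cong (congestion u v) (chains-at-age 0 vs))) (congested-vs u v)))

      at⇒H : ∀ u v → At i u v → Adj H u v
      at⇒H u v (a , refl) =
        cong₂ _∧_ (true-⌊⌋ ((f u ≤? i) ×-dec (i ≤? l u)) (m≤m⊔n (f u) (f v) , index≤lˡ a))
          (cong₂ _∧_ (true-⌊⌋ ((f v ≤? i) ×-dec (i ≤? l v)) (m≤n⊔m (f u) (f v) , index≤lʳ a)) a)

      -- An edge inside bag `i` has index at most `i`. If the index is smaller, both ends start
      -- before `i` and so lie in the adhesion. Clearing the pairs inside the adhesion therefore
      -- leaves edges of index `i` only.
      H⇒at : ∀ u v → Adj H u v → ¬ (boundary i u ≡ true × boundary i v ≡ true) → At i u v
      H⇒at u v e ¬bd = ∧-conicalʳ (Bag f l i v) _ e′ , ≤-antisym (⊔-lub fu≤i fv≤i) (≮⇒≥ index≮i)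
        where
        e′ : Bag f l i v ∧ adj G u v ≡ true
        e′ = ∧-conicalʳ (Bag f l i u) _ e
        u∈ = ⌊⌋-true ((f u ≤? i) ×-dec (i ≤? l u)) (∧-conicalˡ (Bag f l i u) _ e)
        v∈ = ⌊⌋-true ((f v ≤? i) ×-dec (i ≤? l v)) (∧-conicalˡ (Bag f l i v) _ e′)
        fu≤i = proj₁ u∈
        fv≤i = proj₁ v∈
        index≮i : ¬ (index u v < i)
        index≮i q = ¬bd
          ( true-⌊⌋ ((f u <? i) ×-dec (i ≤? l u)) (m⊔n<o⇒m<o (f u) (f v) q , proj₂ u∈)
          , true-⌊⌋ ((f v <? i) ×-dec (i ≤? l v)) (m⊔n<o⇒n<o (f u) (f v) q , proj₂ v∈))

      rest-sound : All (Cycle (At i) ∘ proj₂) K.rest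
      rest-sound = All.tabulate λ {(a , x)} p →
        let ((s , c) , z) = All.lookup cycles p in
        (s , λ u v e → H⇒at u v (c u v e) λ (bu , bv) →
          contradiction
            (trans (sym e) (All.lookup (All.lookup K.vanishing
              (∈-cartesianProduct⁺ (∈-members (boundary i) bu) (∈-members (boundary i) bv))) p))
            (λ ())) , z
        where
        cycles : All (Cycle (Adj H) ∘ proj₂) K.rest
        cycles = K.closed (subspace⇒mixClosed (Cycle-subspace (Adj H))) (All.map⁺ vs-sound)

    localCycles : LocalCycles i
    localCycles = record
      { cycles    = chains K.rest
      ; sound     = All.map⁺ rest-sound
      ; generates = λ { {x} c@(ch , z) → K.generates
          -- Both ends of a pair in the adhesion start before `i`, so a chain of index `i` already
          -- misses it.
          (All.tabulate λ {(u , v)} p →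
            let (u∈ , v∈) = ∈-cartesianProduct⁻ (members (boundary i)) (members (boundary i)) p in
            Chain-false ch u v λ (_ , e) → <-irrefl e
              (⊔-pres-<m (proj₁ (⌊⌋-true ((f u <? i) ×-dec (i ≤? l u)) (All.lookup (members-sound (boundary i)) u∈)))
                         (proj₁ (⌊⌋-true ((f v <? i) ×-dec (i ≤? l v)) (All.lookup (members-sound (boundary i)) v∈)))))
          (subst (λ B → Span B x) (sym (chains-at-age 0 vs))
            (let (coef , e) = spans basis x (cycle⇒F2Cycle H (Chain-mono at⇒H ch , z)) in
             Span-resp vs e (Span-vectors (dim basis) coef (vec basis)))) }
      ; congested = λ u v → ≤-trans (K.congested u v) (*-monoˡ-≤ b (^-monoʳ-≤ 2 length-pairs))
      }

  -- Chains contributed by a single bag.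

  Crossing : ℕ → ESet (n G) → Set
  Crossing i x = Chain (At i) x
    × (∀ v → boundary i v ≡ false → boundary (suc i) v ≡ false → ap (∂ v) x ≡ false)

  Crossing-subspace : ∀ i → Subspace (Crossing i)
  Crossing-subspace i = Chain-subspace (At i) ∩ ⋂ (λ v → ⋂ (λ _ → ⋂ (λ _ → Ker (∂ v))))

  Crossing? : ∀ i x → Dec (Crossing i x)
  Crossing? i x =
    Chain? (λ u v → (adj G u v ≟ true) ×-dec (index u v ℕ.≟ i)) x
    ×-dec all? (λ v → (boundary i v ≟ false) →-dec ((boundary (suc i) v ≟ false) →-dec (ap (∂ v) x ≟ false)))

  record LocalChains (i : ℕ) : Set₁ where
    field
      new       : List (Aged (n G))
      bounded   : length new ≤ k + k
      good      : All (Good (suc i)) new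
      ages      : All (λ p → proj₁ p ≡ i) new
      generates : ∀ {x} → Crossing i x → Span (chains new ++ LocalCycles.cycles (localCycles i)) x

  -- Eliminate the boundary at the at most `2k` vertices of the two adhesions. The pivots become the
  -- new chains; the rest has no boundary anywhere and is already spanned by the local cycles.
  localChains : ∀ i → LocalChains i
  localChains i = record
    { new       = K.kept
    ; bounded   = ≤-trans K.bounded (≤-trans
        (≤-reflexive (trans (length-++ (members (boundary i)))
          (cong₂ _+_ (length-members (boundary i)) (length-members (boundary (suc i))))))
        (+-mono-≤ (narrow i) (narrow (suc i))))
    ; good      = proj₁ (K.closed {Good (suc i)} (Good-mix (suc i))
        (All.map⁺ (All.map (λ w → Chain-mono at⇒within (proj₁ w)) sound)))
    ; ages      = proj₁ (K.closed {λ p → proj₁ p ≡ i} (λ _ _ _ e _ → e) (All.map⁺ (All.map (λ _ → refl) sound)))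
    ; generates = λ {x} w →
        Span-trans (All.++⁺ (All.map (Span-++ˡ (chains K.kept) cycles) (Span-self (chains K.kept)))
                            (All.map⁺ (All.map (Span-++ʳ (chains K.kept) cycles ∘ L.generates) rest-cycles)))
          (Span-trans K.generates (subst (λ B → Span B x) (sym (chains-at-age i all)) (complete w)))
    }
    where
    module L = LocalCycles (localCycles i)
    open L using (cycles)

    enumeration : Σ (List (ESet (n G))) λ B → All (Crossing i) B × (∀ {x} → Crossing i x → Span B x)
    enumeration = enumerate (Crossing? i) (resp (Crossing-subspace i))

    all : List (ESet (n G))
    all = proj₁ enumeration

    sound : All (Crossing i) all
    sound = proj₁ (proj₂ enumeration)

    complete : ∀ {x} → Crossing i x → Span all x
    complete = proj₂ (proj₂ enumeration)

    vs : List V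
    vs = members (boundary i) ++ members (boundary (suc i))

    module K = Pivots (pivots ∂ vs (at-age i all))

    at⇒within : ∀ u v → At i u v → Within i (suc i) u v
    at⇒within u v (a , refl) = a , ≤-refl , ≤-refl

    rest-cycles : All (Cycle (At i) ∘ proj₂) K.rest
    rest-cycles = All.tabulate λ {(a , x)} p →
      let (c , z) = All.lookup crossing p in
      c , λ v → vanish p z v (boundary i v) refl (boundary (suc i) v) refl
      where
      crossing : All (Crossing i ∘ proj₂) K.rest
      crossing = proj₂ (K.closed (subspace⇒mixClosed (Crossing-subspace i)) (All.map⁺ sound))

      vanish : ∀ {a x} → (a , x) ∈ K.rest →
        (∀ v → boundary i v ≡ false → boundary (suc i) v ≡ false → ap (∂ v) x ≡ false) →
        ∀ v c → boundary i v ≡ c → ∀ d → boundary (suc i) v ≡ d → ap (∂ v) x ≡ false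
      vanish p z v true  e d     e′ = All.lookup (∂-vanishing (boundary i)
        (All.++⁻ˡ (members (boundary i)) K.vanishing) v e) p
      vanish p z v false e true  e′ = All.lookup (∂-vanishing (boundary (suc i))
        (All.++⁻ʳ (members (boundary i)) K.vanishing) v e′) p
      vanish p z v false e false e′ = z v e e′

  -- The invariant of the sweep and its preservation.

  M : ℕ
  M = (k + (k + k)) + 2 ^ (k * k) * b

  -- A pending chain is charged to every index its age permits, whether or not it uses such an edge
  -- now, so later additions are paid for in advance. Bounding the pending chains by the size of the
  -- current adhesion, not just by `k`, leaves none at the end.
  record State (i : ℕ) : Set where
    field
      finished  : List (ESet (n G))
      pending   : List (Aged (n G))
      cycles    : All (Cycle (Before i)) finished
      good      : All (Good i) pending
      bounded   : length pending ≤ count (boundary i)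
      generates : ∀ {x} → Partial i x → Span (chains pending ++ finished) x
      congested : ∀ u v → index u v < i → started (index u v) pending + congestion u v finished ≤ M

  start : State 0
  start = record
    { finished = [] ; pending = [] ; cycles = [] ; good = [] ; bounded = z≤n
    ; generates = λ (c , _) u v → Chain-false c u v (λ ())
    ; congested = λ u v () }

  earlier later : ℕ → ESet (n G) → ESet (n G)
  earlier i x u v = x u v ∧ ⌊ index u v <? i ⌋
  later   i x u v = x u v ∧ not ⌊ index u v <? i ⌋

  earlier⊕later : ∀ i x → (earlier i x ⊕ later i x) ≐ x
  earlier⊕later i x u v with x u v | ⌊ index u v <? i ⌋
  ... | false | _     = refl
  ... | true  | false = refl
  ... | true  | true  = refl

  index<-sym : ∀ i u v → ⌊ index u v <? i ⌋ ≡ ⌊ index v u <? i ⌋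
  index<-sym i u v = cong (λ j → ⌊ j <? i ⌋) (⊔-comm (f u) (f v))

  module _ (i : ℕ) {x : ESet (n G)} (p : Partial (suc i) x) where
    private
      c = proj₁ p
      z = proj₂ p

      earlier-chain : Chain (Before i) (earlier i x)
      earlier-chain =
        (λ u v → cong₂ _∧_ (proj₁ c u v) (index<-sym i u v)) ,
        (λ u v e → proj₁ (proj₂ c u v (∧-conicalˡ (x u v) _ e)) ,
                   ⌊⌋-true (index u v <? i) (∧-conicalʳ (x u v) _ e))

      later-chain : Chain (At i) (later i x)
      later-chain =
        (λ u v → cong₂ _∧_ (proj₁ c u v) (cong not (index<-sym i u v))) ,
        (λ u v e → let (a , q) = proj₂ c u v (∧-conicalˡ (x u v) _ e) in
                   a , ≤-antisym (≤-pred q)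
                         (≮⇒≥ (⌊⌋-false (index u v <? i) (not-injective (∧-conicalʳ (x u v) _ e)))))

      ∂-split : ∀ v → ap (∂ v) (earlier i x) xor ap (∂ v) (later i x) ≡ ap (∂ v) x
      ∂-split v = trans (sym (ap-⊕ (∂ v) (earlier i x) (later i x))) (ap-cong (∂ v) (earlier⊕later i x))

      ∂-earlier : ∀ v → i ≤ f v → ap (∂ v) (earlier i x) ≡ false
      ∂-earlier v i≤ = parity-false _ λ w → Chain-false earlier-chain v w
        λ (_ , q) → <⇒≱ (m⊔n<o⇒m<o (f v) (f w) q) i≤

      ∂-later : ∀ v → l v < i → ap (∂ v) (later i x) ≡ false
      ∂-later v l< = parity-false _ λ w → Chain-false later-chain v w
        λ { (a , refl) → <⇒≱ l< (index≤lˡ a) }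

      outside : ∀ v → boundary i v ≡ false → i ≤ f v ⊎ l v < i
      outside v e with f v <? i | i ≤? l v
      ... | no q  | _    = inj₁ (≮⇒≥ q)
      ... | yes q | no r = inj₂ (≰⇒> r)

      ∂-ended : ∀ v → l v < i → ap (∂ v) x ≡ false
      ∂-ended v l< = z v (false-⌊⌋ ((f v <? suc i) ×-dec (suc i ≤? l v)) λ (_ , q) → <⇒≱ l< (<⇒≤ q))

    -- Off the adhesion, a vertex either starts at `i` or later and meets no earlier edge, or has
    -- ended and meets no later edge; in the second case the earlier part inherits the zero boundary
    -- of `x`.
    earlier-partial : Partial i (earlier i x)
    earlier-partial = earlier-chain , λ v e → [ ∂-earlier v , ended v ] (outside v e)
      where
      ended : ∀ v → l v < i → ap (∂ v) (earlier i x) ≡ false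
      ended v l< = trans (sym (xor-identityʳ _))
        (trans (cong (ap (∂ v) (earlier i x) xor_) (sym (∂-later v l<))) (trans (∂-split v) (∂-ended v l<)))

    -- The mirror argument: where no earlier edge arrives, the later part has the boundary of `x`,
    -- which is zero outside the next adhesion.
    later-crossing : Crossing i (later i x)
    later-crossing = later-chain , λ v e e′ → [ unborn v e′ , ∂-later v ] (outside v e)
      where
      unborn : ∀ v → boundary (suc i) v ≡ false → i ≤ f v → ap (∂ v) (later i x) ≡ false
      unborn v e′ i≤ = trans (cong (_xor ap (∂ v) (later i x)) (sym (∂-earlier v i≤))) (trans (∂-split v) (z v e′))

  -- A chain containing an edge is at least as old as the index of that edge.
  congestion≤started : ∀ i u v (P : List (Aged (n G))) → All (Good i) P →
    congestion u v (chains P) ≤ started (index u v) P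
  congestion≤started i u v []            []       = z≤n
  congestion≤started i u v ((a , x) ∷ P) (g ∷ gs) = +-mono-≤ head (congestion≤started i u v P gs)
    where
    head : bit (x u v) ≤ bit ⌊ a ≤? index u v ⌋
    head with x u v in eq
    ... | false = z≤n
    ... | true  = ≤-reflexive (sym (cong bit (true-⌊⌋ (a ≤? index u v) (proj₁ (proj₂ (proj₂ g u v eq))))))

  -- Chains created at bag `i` add no charge to indices already passed.
  unstarted : ∀ i t (P : List (Aged (n G))) → t < i → All (λ p → proj₁ p ≡ i) P → started t P ≡ 0
  unstarted i t []            t< []          = refl
  unstarted i t ((.i , _) ∷ P) t< (refl ∷ es) =
    cong₂ _+_ (cong bit (false-⌊⌋ (i ≤? t) (<⇒≱ t<))) (unstarted i t P t< es)

  -- Pool the pending and the new chains. First eliminate the boundary outside the next adhesion and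
  -- discard the pivots; then eliminate it inside. The second set of pivots becomes pending, and the
  -- remaining vectors are cycles and count as finished.
  step : ∀ i → State i → State (suc i)
  step i s = record
    { finished  = chains Piv.rest ++ Q′
    ; pending   = Piv.kept
    ; cycles    = All.++⁺ (All.map⁺ completed) Q′-cycles
    ; good      = proj₁ pivots-good
    ; bounded   = ≤-trans Piv.bounded (≤-reflexive (length-members (boundary (suc i))))
    ; generates = λ {x} p → subst (λ B → Span B x) (++-assoc (chains Piv.kept) (chains Piv.rest) Q′)
        (Span-trans (All.++⁺ (All.map (Span-++ˡ KR Q′) Piv.generates) (All.++⁻ʳ KR (Span-self (KR ++ Q′))))
          -- Discarding pivots loses nothing here: neither `x` nor the cycles in `Q′` have boundary
          -- outside the next adhesion.
          (Ker.generates Q′ (All.tabulate λ {v} _ → All.map (λ (_ , z) → z v) Q′-cycles)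
            (All.map (λ {v} e → proj₂ p v (not-injective e)) (members-sound outside))
            (subst (λ B → Span B x) (cong (_++ Q′) (sym (map-++ proj₂ S.pending N.new)))
              (partial⇒span p))))
    ; congested = congested
    }
    where
    module S = State s
    module L = LocalCycles (localCycles i)
    module N = LocalChains (localChains i)

    P′ : List (Aged (n G))
    P′ = S.pending ++ N.new

    Q′ : List (ESet (n G))
    Q′ = S.finished ++ L.cycles

    outside : VSet (n G)
    outside v = not (boundary (suc i) v)

    module Ker = Kernel (kernel ∂ (members outside) P′)
    module Piv = Pivots (pivots ∂ (members (boundary (suc i))) Ker.rest)

    KR : List (ESet (n G))
    KR = chains Piv.kept ++ chains Piv.rest

    P′-good : All (Good (suc i)) P′
    P′-good = All.++⁺
      (All.map (Chain-mono (λ u v (a , ≤t , q) → a , ≤t , m<n⇒m<1+n q)) S.good) N.good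

    pivots-good : All (Good (suc i)) Piv.kept × All (Good (suc i)) Piv.rest
    pivots-good = Piv.closed {Good (suc i)} (Good-mix (suc i)) (Ker.closed {Good (suc i)} (Good-mix (suc i)) P′-good)

    Q′-cycles : All (Cycle (Before (suc i))) Q′
    Q′-cycles = All.++⁺
      (All.map (λ (ch , z) → Chain-mono (λ u v (a , q) → a , m<n⇒m<1+n q) ch , z) S.cycles)
      (All.map (λ (ch , z) → Chain-mono (λ { u v (a , refl) → a , ≤-refl }) ch , z) L.sound)

    completed : All (Cycle (Before (suc i)) ∘ proj₂) Piv.rest
    completed = All.tabulate λ {(a , x)} p →
      Chain-mono (λ u v (a , _ , q) → a , q) (All.lookup (proj₂ pivots-good) p) ,
      λ v → vanish p v (boundary (suc i) v) refl
      where
      vanish : ∀ {a x} → (a , x) ∈ Piv.rest → ∀ v c → boundary (suc i) v ≡ c → ap (∂ v) x ≡ false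
      vanish p v true  e = All.lookup (∂-vanishing (boundary (suc i)) Piv.vanishing v e) p
      -- The first elimination cleared these vertices, and the second stays within their kernels.
      vanish p v false e = All.lookup (proj₂ (Piv.closed (subspace⇒mixClosed (Ker (∂ v)))
        (∂-vanishing outside Ker.vanishing v (cong not e)))) p

    -- Cut `x` at index `i`: the invariant handles the earlier part and the chains of the bag the
    -- later one.
    partial⇒span : ∀ {x} → Partial (suc i) x → Span ((chains S.pending ++ chains N.new) ++ Q′) x
    partial⇒span {x} p = Span-resp _ (earlier⊕later i x) (Span-⊕ ((chains S.pending ++ chains N.new) ++ Q′)
      (Span-trans (All.++⁺ open⊆ closed⊆) (S.generates (earlier-partial i p)))
      (Span-trans (All.++⁺ new⊆ local⊆) (N.generates (later-crossing i p))))
      where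
      O = chains S.pending
      C = chains N.new
      T = (O ++ C) ++ Q′
      self : All (Span T) (O ++ C)
      self = All.++⁻ˡ (O ++ C) (Span-self T)
      self′ : All (Span T) Q′
      self′ = All.++⁻ʳ (O ++ C) (Span-self T)
      open⊆   = All.++⁻ˡ O self
      new⊆    = All.++⁻ʳ O self
      closed⊆ = All.++⁻ˡ S.finished self′
      local⊆  = All.++⁻ʳ S.finished self′

    before : ∀ u v → index u v < suc i →
      (started (index u v) S.pending + started (index u v) N.new)
        + (congestion u v S.finished + congestion u v L.cycles) ≤ M
    before u v q with index u v <? i
    -- An index already passed: new chains and local cycles contribute zero, so the old bound
    -- carries over.
    ... | yes r = begin
      (started t S.pending + started t N.new) + (congestion u v S.finished + congestion u v L.cycles)
        ≡⟨ cong₂ (λ y z → (started t S.pending + y) + (congestion u v S.finished + z))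
             (unstarted i t N.new r N.ages)
             (congestion-0 u v L.cycles (All.map (λ (ch , _) → Chain-false ch u v λ (_ , e) → <⇒≢ r e) L.sound)) ⟩
      (started t S.pending + 0) + (congestion u v S.finished + 0)
        ≡⟨ cong₂ _+_ (+-identityʳ (started t S.pending)) (+-identityʳ (congestion u v S.finished)) ⟩
      started t S.pending + congestion u v S.finished             ≤⟨ S.congested u v r ⟩
      M ∎
      where
      open ≤-Reasoning
      t = index u v
    -- Index `i` occurs for the first time, and no finished cycle uses it. The charge is at most `k`
    -- pending chains, `2k` new ones and the local cycles, which is how `M` arises.
    ... | no r = +-mono-≤
      (+-mono-≤ (≤-trans (started≤length _ S.pending) (≤-trans S.bounded (narrow i)))
                (≤-trans (started≤length _ N.new) N.bounded))
      (≤-trans (≤-reflexive (cong (_+ congestion u v L.cycles)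
                 (congestion-0 u v S.finished (All.map (λ (ch , _) → Chain-false ch u v λ (_ , e) → r e) S.cycles))))
               (L.congested u v))

    congested : ∀ u v → index u v < suc i →
      started (index u v) Piv.kept + congestion u v (chains Piv.rest ++ Q′) ≤ M
    congested u v q = begin
      started t Piv.kept + congestion u v (chains Piv.rest ++ Q′)
        ≡⟨ cong (started t Piv.kept +_) (congestion-++ u v (chains Piv.rest) Q′) ⟩
      started t Piv.kept + (congestion u v (chains Piv.rest) + congestion u v Q′)
        -- Finishing a chain turns its reserved charge into actual congestion, which is no larger.
        ≤⟨ +-monoʳ-≤ (started t Piv.kept) (+-monoˡ-≤ _ (congestion≤started (suc i) u v Piv.rest (proj₂ pivots-good))) ⟩
      started t Piv.kept + (started t Piv.rest + congestion u v Q′)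
        ≡⟨ +-assoc (started t Piv.kept) _ _ ⟨
      (started t Piv.kept + started t Piv.rest) + congestion u v Q′
        ≡⟨ cong (_+ congestion u v Q′) (Piv.ages t) ⟩
      started t Ker.rest + congestion u v Q′
        ≤⟨ +-mono-≤ (Ker.ages t) (≤-reflexive (congestion-++ u v S.finished L.cycles)) ⟩
      started t P′ + (congestion u v S.finished + congestion u v L.cycles)
        ≡⟨ cong (_+ (congestion u v S.finished + congestion u v L.cycles)) (started-++ t S.pending N.new) ⟩
      (started t S.pending + started t N.new) + (congestion u v S.finished + congestion u v L.cycles)
        ≤⟨ before u v q ⟩
      M ∎
      where
      open ≤-Reasoning
      t = index u v

  states : ∀ i → State i
  states zero    = start
  states (suc i) = step i (states i)

  -- Past all intervals the adhesion is empty. No chain is pending and every cycle is a partial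
  -- chain, so the finished list spans the cycle space.
  BnLe-M : ∀ m → (∀ v → l v < m) → BnLe G M
  BnLe-M m l<m = spanning⇒BnLe G M S.finished
    (All.map (λ (ch , z) → cycle⇒F2Cycle G (Chain-mono (λ u v → proj₁) ch , z)) S.cycles)
    (λ x c → let (ch , z) = F2Cycle⇒cycle G c in
      closed-spans (S.generates (Chain-mono (λ u v a → a , ≤-<-trans (index≤lˡ a) (l<m u)) ch , λ v _ → z v)))
    (λ u v a → ≤-trans (m≤n+m _ (started (index u v) S.pending))
                       (S.congested u v (≤-<-trans (index≤lˡ a) (l<m u))))
    where
    module S = State (states m)
    nothing-open : length S.pending ≤ 0
    nothing-open = ≤-trans S.bounded (≤-reflexive (count-0 (boundary m) λ v →
      false-⌊⌋ ((f v <? m) ×-dec (m ≤? l v)) λ (_ , q) → <⇒≱ (l<m v) q))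
    closed-spans : ∀ {x} → Span (chains S.pending ++ S.finished) x → Span S.finished x
    closed-spans s with S.pending | nothing-open
    ... | [] | _ = s

-- Path-decompositions as interval assignments

least : ∀ {m} (p : Fin m → Bool) → ∃ (λ t → p t ≡ true) →
  Σ (Fin m) λ t → p t ≡ true × (∀ s → p s ≡ true → toℕ t ≤ toℕ s)
least {suc m} p (t , e) with p fz in eq
least {suc m} p (t    , e) | true  = fz , eq , λ s _ → z≤n
least {suc m} p (fz   , e) | false = contradiction (trans (sym e) eq) (λ ())
least {suc m} p (fs t , e) | false with least (λ i → p (fs i)) (t , e)
... | t′ , e′ , h = fs t′ , e′ , λ { fz e″ → contradiction (trans (sym e″) eq) (λ ())
                                   ; (fs s) e″ → s≤s (h s e″) }

greatest : ∀ {m} (p : Fin m → Bool) → ∃ (λ t → p t ≡ true) →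
  Σ (Fin m) λ t → p t ≡ true × (∀ s → p s ≡ true → toℕ s ≤ toℕ t)
greatest {suc m} p te with Fin.any? (λ i → p (fs i) ≟ true)
greatest {suc m} p te | yes te′ with greatest (λ i → p (fs i)) te′
... | t′ , e′ , h = fs t′ , e′ , λ { fz _ → z≤n ; (fs s) e″ → s≤s (h s e″) }
greatest {suc m} p (fz   , e) | no ¬te = fz , e , λ { fz _ → z≤n ; (fs s) e″ → contradiction (s , e″) ¬te }
greatest {suc m} p (fs t , e) | no ¬te = contradiction (t , e) ¬te

count-mono : ∀ {m} (p q : Fin m → Bool) → (∀ i → p i ≡ true → q i ≡ true) → count p ≤ count q
count-mono {zero}  p q h = z≤n
count-mono {suc m} p q h = +-mono-≤ head (count-mono _ _ (λ i → h (fs i)))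
  where
  head : bit (p fz) ≤ bit (q fz)
  head with p fz in eq
  ... | false = z≤n
  ... | true  = ≤-reflexive (sym (cong bit (h fz eq)))

edgeless-BnLe : (G : Graph) (m : ℕ) → (∀ u v → adj G u v ≡ false) → BnLe G m
edgeless-BnLe G m e = spanning⇒BnLe G m [] []
  (λ x (c , _) u v → Chain-false c u v (λ a → contradiction (trans (sym a) (e u v)) (λ ())))
  (λ u v _ → z≤n)

module _ (G : Graph) (D : PathDecomposition G) (k b : ℕ) (adh : AdhesionLe G D k)
  (bags : ∀ (t : Fin (len D)) (A : VSet (n G)) → A ⊆ᵥ bag D t → BnLe (induced G A) b) where
  private
    first : ∀ v → Σ (Fin (len D)) λ t → bag D t v ≡ true × (∀ s → bag D s v ≡ true → toℕ t ≤ toℕ s)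
    first v = least (λ t → bag D t v) (coverV D v)

    last : ∀ v → Σ (Fin (len D)) λ t → bag D t v ≡ true × (∀ s → bag D s v ≡ true → toℕ s ≤ toℕ t)
    last v = greatest (λ t → bag D t v) (coverV D v)

    f l : Fin (n G) → ℕ
    f v = toℕ (proj₁ (first v))
    l v = toℕ (proj₁ (last v))

    f≤l : ∀ v → f v ≤ l v
    f≤l v = proj₂ (proj₂ (first v)) (proj₁ (last v)) (proj₁ (proj₂ (last v)))

    l<len : ∀ v → l v < len D
    l<len v = Fin.toℕ<n (proj₁ (last v))

    edge : ∀ u v → Adj G u v → f u ≤ l v
    edge u v a = let (t , tu , tv) = coverE D u v a in
      ≤-trans (proj₂ (proj₂ (first u)) t tu) (proj₂ (proj₂ (last v)) t tv)

    in-bag : ∀ v i (i< : i < len D) → f v ≤ i → i ≤ l v → bag D (Fin.fromℕ< i<) v ≡ true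
    in-bag v i i< f≤ ≤l = interp D v (proj₁ (first v)) (Fin.fromℕ< i<) (proj₁ (last v))
      (≤-trans f≤ (≤-reflexive (sym (Fin.toℕ-fromℕ< i<))))
      (≤-trans (≤-reflexive (Fin.toℕ-fromℕ< i<)) ≤l)
      (proj₁ (proj₂ (first v))) (proj₁ (proj₂ (last v)))

    -- By the subpath property the boundary at `j + 1` lies in bags `j` and `j + 1`. At 0 and past
    -- the last bag it is empty.
    narrow : ∀ i → count (Boundary f l i) ≤ k
    narrow i with i <? len D
    narrow i       | no i≮ = ≤-trans (≤-reflexive (count-0 (Boundary f l i) λ v →
      false-⌊⌋ ((f v <? i) ×-dec (i ≤? l v)) λ (_ , q) → i≮ (≤-<-trans q (l<len v)))) z≤n
    narrow zero    | yes i< = ≤-trans (≤-reflexive (count-0 (Boundary f l 0) λ v →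
      false-⌊⌋ ((f v <? 0) ×-dec (0 ≤? l v)) λ { (() , _) })) z≤n
    narrow (suc j) | yes i< = ≤-trans
      (count-mono (Boundary f l (suc j)) (λ v → bag D s v ∧ bag D t v) λ v e →
        let (p , q) = ⌊⌋-true ((f v <? suc j) ×-dec (suc j ≤? l v)) e in
        cong₂ _∧_ (in-bag v j j< (≤-pred p) (<⇒≤ q)) (in-bag v (suc j) i< (<⇒≤ p) q))
      (adh s t (trans (Fin.toℕ-fromℕ< i<) (cong suc (sym (Fin.toℕ-fromℕ< j<)))))
      where
      j< : j < len D
      j< = <-trans (n<1+n j) i<
      s = Fin.fromℕ< j<
      t = Fin.fromℕ< i<

    local : ∀ i → BnLe (induced G (Bag f l i)) b
    local i with i <? len D
    ... | yes i< = bags (Fin.fromℕ< i<) (Bag f l i) λ v e →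
      let (p , q) = ⌊⌋-true ((f v ≤? i) ×-dec (i ≤? l v)) e in in-bag v i i< p q
    ... | no i≮ = edgeless-BnLe (induced G (Bag f l i)) b λ u v →
      cong (_∧ (Bag f l i v ∧ adj G u v))
        (false-⌊⌋ ((f u ≤? i) ×-dec (i ≤? l u)) λ (_ , q) → i≮ (≤-<-trans q (l<len u)))

  BnLe-quadratic : BnLe G ((k + (k + k)) + 2 ^ (k * k) * b)
  BnLe-quadratic = Layout.BnLe-M G f l k b f≤l edge narrow local (len D) l<len

-- Numerical estimates and conclusion.

BnLe-mono : (G : Graph) {m m′ : ℕ} → m ≤ m′ → BnLe G m → BnLe G m′
BnLe-mono G m≤m′ (B , cg) = B , λ u v a → ≤-trans (cg u v a) m≤m′

suc≤2^ : ∀ m → suc m ≤ 2 ^ m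
suc≤2^ zero    = ≤-refl
suc≤2^ (suc m) = +-mono-≤ (m^n>0 2 m) (≤-trans (suc≤2^ m) (m≤m+n (2 ^ m) 0))

2+s≤4^s : ∀ s → 1 ≤ s → 2 + s ≤ 2 ^ (2 * s)
2+s≤4^s (suc r) _ = begin
  suc (suc (suc r))            ≤⟨ s≤s (s≤s (s≤s (m≤m+n r (r + 0)))) ⟩
  suc (suc (suc (r + (r + 0)))) ≡⟨ cong (suc ∘ suc) (+-suc r (r + 0)) ⟨
  suc (2 * suc r)              ≤⟨ suc≤2^ (2 * suc r) ⟩
  2 ^ (2 * suc r)              ∎
  where open ≤-Reasoning

m≤m*m : ∀ m → m ≤ m * m
m≤m*m zero    = z≤n
m≤m*m (suc m) = m≤m*n (suc m) (suc m)

-- With `s` the square of `k ⊔ 1`, each of the four summands is at most `c = b * 2 ^ s`; the factor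
-- 4 turns the exponent into `2 + s`. The bound `1 ≤ b` gives `k ≤ c`.
quadratic≤ : ∀ k b → 1 ≤ b → (k + (k + k)) + 2 ^ (k * k) * b ≤ b * 2 ^ (2 ^ (2 * ((k ⊔ 1) ^ 2)))
quadratic≤ k b 1≤b = begin
  (k + (k + k)) + 2 ^ (k * k) * b
    ≤⟨ +-mono-≤ (+-mono-≤ k≤c (+-mono-≤ k≤c k≤c))
      (≤-trans (*-monoˡ-≤ b (^-monoʳ-≤ 2 kk≤s)) (≤-reflexive (*-comm (2 ^ s) b))) ⟩
  (c + (c + c)) + c                 ≡⟨ +-comm (c + (c + c)) c ⟩
  c + (c + (c + c))                 ≡⟨ cong (λ z → c + (c + (c + z))) (+-identityʳ c) ⟨
  4 * (b * 2 ^ s)                   ≡⟨ *-comm 4 c ⟩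
  b * 2 ^ s * 4                     ≡⟨ *-assoc b (2 ^ s) 4 ⟩
  b * (2 ^ s * 4)                   ≡⟨ cong (b *_) (trans (*-comm (2 ^ s) 4) (sym (^-distribˡ-+-* 2 2 s))) ⟩
  b * 2 ^ (2 + s)                   ≤⟨ *-monoʳ-≤ b (^-monoʳ-≤ 2 (2+s≤4^s s 1≤s)) ⟩
  b * 2 ^ (2 ^ (2 * s))             ∎
  where
  open ≤-Reasoning
  s = (k ⊔ 1) ^ 2
  c = b * 2 ^ s
  s≡ : s ≡ (k ⊔ 1) * (k ⊔ 1)
  s≡ = cong ((k ⊔ 1) *_) (*-identityʳ (k ⊔ 1))
  kk≤s : k * k ≤ s
  kk≤s = ≤-trans (*-mono-≤ (m≤m⊔n k 1) (m≤m⊔n k 1)) (≤-reflexive (sym s≡))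
  1≤s : 1 ≤ s
  1≤s = ≤-trans (*-mono-≤ (m≤n⊔m k 1) (m≤n⊔m k 1)) (≤-reflexive (sym s≡))
  k≤c : k ≤ c
  k≤c = ≤-trans (m≤m*m k) (≤-trans kk≤s (≤-trans (<⇒≤ (suc≤2^ s))
    (≤-trans (≤-reflexive (sym (*-identityˡ (2 ^ s)))) (*-monoˡ-≤ (2 ^ s) 1≤b))))

theorem4p1 : Σ ℕ (λ C → (0 < C) ×
    ((b k : ℕ) → 1 ≤ b → (G : Graph) → (D : PathDecomposition G) →
    AdhesionLe G D k →
    (∀ (t : Fin (len D)) (A : VSet (n G)) → A ⊆ᵥ bag D t → BnLe (induced G A) b) →
    BnLe G (b * 2 ^ (2 ^ (C * ((k ⊔ 1) ^ 2))))))
-- The constant 2 comes from `2 + s ≤ 2 ^ (2 * s)`, valid for all `s ≥ 1`.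
theorem4p1 = 2 , s≤s z≤n , λ b k 1≤b G D adh bags →
  BnLe-mono G (quadratic≤ k b 1≤b) (BnLe-quadratic G D k b adh bags)
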